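{- Let $S\subseteq\omega$. There is an algorithm, recursive in $S$ and uniform in (codes for) a finite use-monotone Turing functional $\Phi_0$ and a quantifier-free finitary sentence $\psi$ of $\mathcal L^r_{\omega_1,\omega}(S)$, deciding whether there is a finite set of reals $\mathbf X$ such that $(\Phi_0,\mathbf X)\Vdash_{\mathcal P}\psi$. Furthermore, for reals $A,B$, one can likewise decide whether there is a finite set $\mathbf X$ with $(\Phi_0,\mathbf X)\in\mathcal Q_{A,B}$ and $(\Phi_0,\mathbf X)\Vdash_{\mathcal Q}\psi$, by a procedure uniformly recursive in $A\oplus B\oplus S$.
   Context: Reals are subsets of $\omega$. An axiom is a triple $\langle x,y,\sigma\rangle$ with $x\in\omega$, $y\in\{0,1\}$, $\sigma\in 2^{<\omega}$ (coded by natural numbers via a fixed recursive bijection); it applies to a real $X$ if $\sigma\subset X$. A Turing functional is a set $\Phi$ of axioms such that if $\langle x,y_1,\sigma_1\rangle,\langle x,y_2,\sigma_2\rangle\in\Phi$ with $\sigma_1,\sigma_2$ compatible then $y_1=y_2$, $\sigma_1=\sigma_2$; it is use-monotone if (i) whenever $\langle x_1,y_1,\sigma_1\rangle,\langle x_2,y_2,\sigma_2\rangle\in\Phi$ and $\sigma_1\subsetneq\sigma_2$ then $x_1<x_2$, and (ii) whenever $x_1<x_2$ and $\langle x_2,y_2,\sigma_2\rangle\in\Phi$ there are $y_1$ and $\sigma_1\subsetneq\sigma_2$ with $\langle x_1,y_1,\sigma_1\rangle\in\Phi$. Write $\Phi(X)(x)=y$ if some $\langle x,y,\tau\rangle\in\Phi$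 applies to $X$. Finite functionals are coded as natural numbers. Kumabe–Slaman forcing $\mathcal P$: conditions $p=(\Phi_p,\mathbf X_p)$ with $\Phi_p$ a finite use-monotone Turing functional and $\mathbf X_p$ a finite set of reals; $q\le_{\mathcal P}p$ iff $\Phi_p\subseteq\Phi_q$, every axiom in $\Phi_q\setminus\Phi_p$ has string longer than the string of every axiom of $\Phi_p$, $\mathbf X_p\subseteq\mathbf X_q$, and for all $X\in\mathbf X_p$ and all $x,y$, $\Phi_q(X)(x)=y$ implies $\Phi_p(X)(x)=y$. $\Phi$ partially computes $B$ on input $A$ if every axiom $\langle x,y,\sigma\rangle\in\Phi$ with $\sigma\subset A$ has $y=B(x)$. $\mathcal Q_{A,B}$ is the suborder of $\mathcal P$ of conditions $q$ such that $\Phi_q$ partially computes $B$ on input $A$ and $A\notin\mathbf X_q$. The language $\mathcal L^r_{\omega_1,\omega}(S)$: the $S$-recursive infinitary formulas (in the sense of Ash–Knight) built over the symbols: numerals (also representing strings via a fixed recursive bijection $2^{<\omega}\to\omega$), a 5-ary relation $\phi(e,x,s,y,\sigma)$ meaning $\{e\}^\sigma_s(x)\downarrow=y$, a predicate $\sigma\subset\mathtt S$, and a predicate $\sigma\subset\Phi_{\mathtt G}$ (for the characteristic function of the generic functional, viewed as a set of codes of axioms); ground-level (quantifier-free finitary) formulas are in conjunctive normal form. The relation $\Vdash_{\mathcal P}$ on atomic and quantifier-free sentences: $p\Vdash n=m$ iff $n=m$; $p\Vdash\phi(e,x,s,y,\sigma)$ iff $\{e\}^\sigma_s(x)\downarrow=y$;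 $p\Vdash\sigma\subset\mathtt S$ iff $\sigma\subset S$; $p\Vdash\sigma\subset\Phi_{\mathtt G}$ iff for all $n<|\sigma|$: if $\sigma(n)=1$ then $n\in\Phi_p$, and if $\sigma(n)=0$ then either $n$ codes no axiom, or $n$ codes an axiom $\langle x,y,\tau\rangle\notin\Phi_p$ which is prevented from entering any extension of $p$ (because $\Phi_p$ has an axiom $\langle x_0,y_0,\tau_0\rangle$ with $|\tau_0|>|\tau|$, or with $x_0>x$ and $\tau_0$ compatible with $\tau$, or because $\tau$ is an initial segment of some member of $\mathbf X_p$); for atomic $\psi$, $p\Vdash\neg\psi$ iff no $q\le p$ forces $\psi$; $p$ forces a finite disjunction of literals iff every $q\le p$ has an extension $r$ forcing one of the literals; $p$ forces a finite conjunction iff it forces each conjunct. $\Vdash_{\mathcal Q}$ is defined the same way within $\mathcal Q_{A,B}$, except that in the clause for $\sigma(n)=0$ there is the additional possibility that $n$ codes $\langle x,y,\tau\rangle$ with $\tau\subset A$ and $y\neq B(x)$. -}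

module Defs where

open import Data.Nat using (ℕ; zero; suc; _<_; _/_; _%_)
open import Data.Bool using (Bool; true; false)
open import Data.List using (List; []; _∷_; length)
open import Data.List.Membership.Propositional using (_∈_; _∉_)
open import Data.Product using (Σ; ∃; _×_; _,_; proj₁; proj₂)
open import Data.Sum using (_⊎_)
open import Data.Maybe using (Maybe; just; nothing)
open import Data.Unit using (⊤)
open import Data.Empty using (⊥)
open import Relation.Nullary using (¬_)
open import Relation.Binary.PropositionalEquality using (_≡_; _≢_)

-- A real is a subset of ω, given by its characteristic function.
Real : Set
Real = ℕ → Bool

Str : Set
Str = List Bool

_⊏_ : Str → Real → Set
[]      ⊏ X = ⊤
(b ∷ σ) ⊏ X = (b ≡ X 0) × (σ ⊏ (λ n → X (suc n)))

data _⊑_ : Str → Str → Set where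
  []⊑  : ∀ {τ} → [] ⊑ τ
  ∷⊑   : ∀ {b σ τ} → σ ⊑ τ → (b ∷ σ) ⊑ (b ∷ τ)

_⊏ₛ_ : Str → Str → Set
σ ⊏ₛ τ = (σ ⊑ τ) × (σ ≢ τ)

Compatible : Str → Str → Set
Compatible σ τ = (σ ⊑ τ) ⊎ (τ ⊑ σ)

_∈ᵣ_ : Real → List Real → Set
X ∈ᵣ Xs = ∃ λ Y → (Y ∈ Xs) × (∀ n → X n ≡ Y n)

record Axiom : Set where
  constructor ⟨_,_,_⟩
  field
    ax-x : ℕ
    ax-y : Bool
    ax-σ : Str
open Axiom public

Functional : Set
Functional = List Axiom

IsTuringFunctional : Functional → Set
IsTuringFunctional Φ = ∀ {a₁ a₂} → a₁ ∈ Φ → a₂ ∈ Φ → ax-x a₁ ≡ ax-x a₂ →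
  Compatible (ax-σ a₁) (ax-σ a₂) → (ax-y a₁ ≡ ax-y a₂) × (ax-σ a₁ ≡ ax-σ a₂)

IsUseMonotone : Functional → Set
IsUseMonotone Φ =
  (∀ {a₁ a₂} → a₁ ∈ Φ → a₂ ∈ Φ → ax-σ a₁ ⊏ₛ ax-σ a₂ → ax-x a₁ < ax-x a₂)
  × (∀ {x₁ a₂} → x₁ < ax-x a₂ → a₂ ∈ Φ →
       ∃ λ a₁ → (a₁ ∈ Φ) × (ax-x a₁ ≡ x₁) × (ax-σ a₁ ⊏ₛ ax-σ a₂))

Apply : Functional → Real → ℕ → Bool → Set
Apply Φ X x y = ∃ λ a → (a ∈ Φ) × (ax-x a ≡ x) × (ax-y a ≡ y) × (ax-σ a ⊏ X)

PartiallyComputes : Functional → Real → Real → Set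
PartiallyComputes Φ A B = ∀ {a} → a ∈ Φ → ax-σ a ⊏ A → ax-y a ≡ B (ax-x a)

-- bijection ℕ → 2^{<ω}: 0 ↦ [], 2k+1 ↦ 0⌢str k, 2k+2 ↦ 1⌢str k
strFuel : ℕ → ℕ → Str
strFuel zero    _       = []
strFuel (suc f) zero    = []
strFuel (suc f) (suc m) with m % 2
... | zero  = false ∷ strFuel f (m / 2)
... | suc _ = true  ∷ strFuel f (m / 2)

decodeStr : ℕ → Str
decodeStr n = strFuel n n

-- inverse of the Cantor pairing function
unpair : ℕ → ℕ × ℕ
unpair zero = 0 , 0
unpair (suc n) with unpair n
... | zero  , b = suc b , 0
... | suc a , b = a , suc b

-- n codes the axiom ⟨x,y,τ⟩ iff n = ⟨x,⟨y,code τ⟩⟩ with y ∈ {0,1}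
decodeAxiom : ℕ → Maybe Axiom
decodeAxiom n with unpair n
... | x , m with unpair m
...   | 0 , k           = just ⟨ x , false , decodeStr k ⟩
...   | 1 , k           = just ⟨ x , true  , decodeStr k ⟩
...   | suc (suc _) , _ = nothing

record Condition : Set where
  constructor cond
  field
    Φc      : Functional
    Φc-fun  : IsTuringFunctional Φc
    Φc-um   : IsUseMonotone Φc
    Xc      : List Real
open Condition public

_≤P_ : Condition → Condition → Set
q ≤P p =
  (∀ {a} → a ∈ Φc p → a ∈ Φc q)
  × (∀ {a b} → a ∈ Φc q → a ∉ Φc p → b ∈ Φc p → length (ax-σ b) < length (ax-σ a))
  × (∀ {X} → X ∈ Xc p → X ∈ᵣ Xc q)
  × (∀ {X} → X ∈ Xc p → ∀ x y → Apply (Φc q) X x y → Apply (Φc p) X x y)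

InQ : Real → Real → Condition → Set
InQ A B q = PartiallyComputes (Φc q) A B × ¬ (A ∈ᵣ Xc q)

data Atom : Set where
  eqA   : ℕ → ℕ → Atom
  compA : ℕ → ℕ → ℕ → ℕ → Str → Atom
  inSA  : Str → Atom
  inGA  : Str → Atom

data Literal : Set where
  pos : Atom → Literal
  neg : Atom → Literal

data Clause : Set where
  cLit  : Literal → Clause
  cDisj : List Literal → Clause

data QFSentence : Set where
  sClause : Clause → QFSentence
  sConj   : List Clause → QFSentence

-- The forcing relation, parametrised by
--   comp    : the fixed step-bounded oracle computation, comp e x s y σ = true
--             iff {e}^σ_s(x)↓ = y
--   S       : the parameter real
--   InPos   : the suborder (⊤ for P, InQ A B for Q_{A,B})
--   Extra   : extra reason for an axiom to be excluded (⊥ for P)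

module Forcing (comp : ℕ → ℕ → ℕ → ℕ → Str → Bool) (S : Real)
               (InPos : Condition → Set) (Extra : Axiom → Set) where

  -- the axiom a is prevented from entering any extension of p
  Prevented : Condition → Axiom → Set
  Prevented p a =
    (∃ λ b → (b ∈ Φc p) × (length (ax-σ a) < length (ax-σ b)))
    ⊎ (∃ λ b → (b ∈ Φc p) × (ax-x a < ax-x b) × Compatible (ax-σ b) (ax-σ a))
    ⊎ (∃ λ X → (X ∈ Xc p) × (ax-σ a ⊏ X))
    ⊎ Extra a

  GBit : Condition → ℕ → Bool → Set
  GBit p n true  = ∃ λ a → (decodeAxiom n ≡ just a) × (a ∈ Φc p)
  GBit p n false = (decodeAxiom n ≡ nothing)
    ⊎ (∃ λ a → (decodeAxiom n ≡ just a) × (a ∉ Φc p) × Prevented p a)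

  ForcesG : Condition → ℕ → Str → Set
  ForcesG p n []      = ⊤
  ForcesG p n (b ∷ σ) = GBit p n b × ForcesG p (suc n) σ

  ForcesAtom : Condition → Atom → Set
  ForcesAtom p (eqA n m)           = n ≡ m
  ForcesAtom p (compA e x s y σ)   = comp e x s y σ ≡ true
  ForcesAtom p (inSA σ)            = σ ⊏ S
  ForcesAtom p (inGA σ)            = ForcesG p 0 σ

  ForcesLit : Condition → Literal → Set
  ForcesLit p (pos φ) = ForcesAtom p φ
  ForcesLit p (neg φ) = ¬ (∃ λ q → InPos q × (q ≤P p) × ForcesAtom q φ)

  data AnyLit (r : Condition) : List Literal → Set where
    here  : ∀ {l ls} → ForcesLit r l → AnyLit r (l ∷ ls)
    there : ∀ {l ls} → AnyLit r ls → AnyLit r (l ∷ ls)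

  ForcesClause : Condition → Clause → Set
  ForcesClause p (cLit l)   = ForcesLit p l
  ForcesClause p (cDisj ls) = ∀ q → InPos q → q ≤P p →
    ∃ λ r → InPos r × (r ≤P q) × AnyLit r ls

  data AllClauses (p : Condition) : List Clause → Set where
    []  : AllClauses p []
    _∷_ : ∀ {c cs} → ForcesClause p c → AllClauses p cs → AllClauses p (c ∷ cs)

  Forces : Condition → QFSentence → Set
  Forces p (sClause c) = ForcesClause p c
  Forces p (sConj cs)  = AllClauses p cs

ForcesP : (ℕ → ℕ → ℕ → ℕ → Str → Bool) → Real → Condition → QFSentence → Set
ForcesP comp S = Forcing.Forces comp S (λ _ → ⊤) (λ _ → ⊥)

ForcesQ : (ℕ → ℕ → ℕ → ℕ → Str → Bool) → Real → Real → Real →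
          Condition → QFSentence → Set
ForcesQ comp A B S = Forcing.Forces comp S (InQ A B)
  (λ a → (ax-σ a ⊏ A) × (ax-y a ≢ B (ax-x a)))

-- Extensions of p only add axioms with strings longer than those of Φ_p, and by
-- functionality such an axiom cannot apply to a real of X_p. So once X_p contains, for every
-- axiom coded below N, a real extending its string, the generic functional is frozen below N,
-- and p forces a quantifier-free ψ mentioning only G-bits below N iff ψ is true with G read
-- off Φ_p, a decidable property of Φ_p alone. Conversely, a condition forcing a negation or a
-- disjunction constrains in particular its frozen extension, where forcing and truth
-- coincide, so forcing always implies that truth. Hence a suitable X exists iff ψ is true of Φ₀; for Q_{A,B} the blocking
-- reals are chosen different from A, and the only further requirement is that Φ₀ partially
-- computes B on input A.
module Submission where

open import Defs
open import Data.Nat using (ℕ)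
open import Data.Bool using (Bool)
open import Data.List using (List)
open import Data.Product using (∃; _×_)
open import Relation.Nullary using (Dec)

open import Data.Nat using (zero; suc; _<_; _≤_; _+_; z<s)
open import Data.Nat.Properties
  using (≤-refl; <-irrefl; <-≤-trans; +-suc; m≤m+n; m≤n+m; m<m+n)
open import Data.Bool using (true; false; not)
open import Data.Bool.Properties using (not-¬)
open import Data.List using ([]; _∷_; _++_; length; map; applyUpTo)
open import Data.Nat.ListAction using (sum)
open import Data.List.Properties using (≡-dec)
open import Data.List.Membership.Propositional using (_∈_; _∉_)
open import Data.List.Membership.Propositional.Properties
  using (∈-++⁺ˡ; ∈-++⁺ʳ; ∈-++⁻; ∈-applyUpTo⁺; ∈-applyUpTo⁻)
open import Data.List.Relation.Unary.Any using (Any; here; there; any?)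
open import Data.List.Relation.Unary.All as All using (All; []; _∷_; all?)
open import Data.Maybe using (just; nothing; maybe)
open import Data.Product using (_,_; proj₁; proj₂; swap)
open import Data.Sum using (_⊎_; inj₁; inj₂; [_,_]′)
open import Data.Unit using (⊤; tt)
open import Data.Empty using (⊥; ⊥-elim)
open import Function using (_∘_)
open import Function.Bundles using (_⇔_; mk⇔)
open import Relation.Nullary using (¬_; yes; no)
open import Relation.Nullary.Decidable using (_×-dec_; _→-dec_; ¬?; map′)
import Relation.Nullary.Decidable as Dec
open import Relation.Binary.PropositionalEquality
  using (_≡_; _≢_; refl; sym; trans; cong; subst)
import Data.Nat as ℕ
import Data.Bool as Bool

_≟ᵃ_ : (a b : Axiom) → Dec (a ≡ b)
⟨ x , y , σ ⟩ ≟ᵃ ⟨ x′ , y′ , σ′ ⟩ with x ℕ.≟ x′ | y Bool.≟ y′ | ≡-dec Bool._≟_ σ σ′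
... | yes refl | yes refl | yes refl = yes refl
... | no x≢x′  | _        | _        = no λ { refl → x≢x′ refl }
... | yes _    | no y≢y′  | _        = no λ { refl → y≢y′ refl }
... | yes _    | yes _    | no σ≢σ′  = no λ { refl → σ≢σ′ refl }

open import Data.List.Membership.DecPropositional _≟ᵃ_ using (_∈?_)

_⊏?_ : ∀ σ X → Dec (σ ⊏ X)
[]      ⊏? X = yes tt
(b ∷ σ) ⊏? X = (b Bool.≟ X 0) ×-dec (σ ⊏? (X ∘ suc))

⊏-resp : ∀ {X Y} σ → (∀ n → X n ≡ Y n) → σ ⊏ X → σ ⊏ Y
⊏-resp []      X≗Y _          = tt
⊏-resp (b ∷ σ) X≗Y (b≡ , σ⊏) = trans b≡ (X≗Y 0) , ⊏-resp σ (X≗Y ∘ suc) σ⊏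

⊏-compatible : ∀ X σ τ → σ ⊏ X → τ ⊏ X → Compatible σ τ
⊏-compatible X []      τ       _ _ = inj₁ []⊑
⊏-compatible X (_ ∷ σ) []      _ _ = inj₂ []⊑
⊏-compatible X (_ ∷ σ) (_ ∷ τ) (refl , σ⊏) (refl , τ⊏)
  with ⊏-compatible (X ∘ suc) σ τ σ⊏ τ⊏
... | inj₁ σ⊑τ = inj₁ (∷⊑ σ⊑τ)
... | inj₂ τ⊑σ = inj₂ (∷⊑ τ⊑σ)

extendAvoiding : Real → Str → Real
extendAvoiding A []      n       = not (A n)
extendAvoiding A (b ∷ τ) zero    = b
extendAvoiding A (b ∷ τ) (suc n) = extendAvoiding (A ∘ suc) τ n

⊏-extendAvoiding : ∀ A τ → τ ⊏ extendAvoiding A τ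
⊏-extendAvoiding A []      = tt
⊏-extendAvoiding A (b ∷ τ) = refl , ⊏-extendAvoiding (A ∘ suc) τ

extendAvoiding-differs : ∀ A τ → extendAvoiding A τ (length τ) ≡ not (A (length τ))
extendAvoiding-differs A []      = refl
extendAvoiding-differs A (b ∷ τ) = extendAvoiding-differs (A ∘ suc) τ

partiallyComputes? : ∀ Φ A B → Dec (PartiallyComputes Φ A B)
partiallyComputes? Φ A B =
  map′ (λ all a∈ → All.lookup all a∈) (λ pc → All.tabulate pc)
    (all? (λ a → (ax-σ a ⊏? A) →-dec (ax-y a Bool.≟ B (ax-x a))) Φ)

≤P-refl : ∀ p → p ≤P p
≤P-refl p = (λ a∈ → a∈) , (λ a∈ a∉ _ → ⊥-elim (a∉ a∈))
          , (λ {X} X∈ → X , X∈ , λ _ → refl) , (λ _ _ _ ap → ap)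

withBlockers : Condition → List Real → Condition
withBlockers p Ys = record p { Xc = Xc p ++ Ys }

withBlockers-≤P : ∀ p Ys → withBlockers p Ys ≤P p
withBlockers-≤P p Ys = (λ a∈ → a∈) , (λ a∈ a∉ _ → ⊥-elim (a∉ a∈))
                     , (λ {X} X∈ → X , ∈-++⁺ˡ X∈ , λ _ → refl) , (λ _ _ _ ap → ap)

-- Were a new in r, conservativity on X would give an old axiom with the same input and a
-- string compatible with, hence (functionality) equal to, that of a; but new strings are longer.
blocked-∈ : ∀ {r q X a} → r ≤P q → X ∈ Xc q → ax-σ a ⊏ X → a ∈ Φc r → a ∈ Φc q
blocked-∈ {r} {q} {X} {a} (⊆Φ , longer , _ , conservative) X∈ σ⊏X a∈r with a ∈? Φc q
... | yes a∈q = a∈q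
... | no a∉q with conservative X∈ (ax-x a) (ax-y a) (a , a∈r , refl , refl , σ⊏X)
... | b , b∈q , x≡ , _ , τ⊏X = ⊥-elim (<-irrefl (cong length σ≡τ) (longer a∈r a∉q b∈q))
  where
    σ≡τ : ax-σ b ≡ ax-σ a
    σ≡τ = sym (proj₂ (Φc-fun r a∈r (⊆Φ b∈q) (sym x≡)
                              (⊏-compatible X (ax-σ a) (ax-σ b) σ⊏X τ⊏X)))

BlocksBelow : List Real → ℕ → Set
BlocksBelow Xs N = ∀ {m a} → m < N → decodeAxiom m ≡ just a → ∃ λ X → X ∈ Xs × ax-σ a ⊏ X

BlocksBelow-≤ : ∀ {Xs M N} → M ≤ N → BlocksBelow Xs N → BlocksBelow Xs M
BlocksBelow-≤ M≤N blocks m<M = blocks (<-≤-trans m<M M≤N)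

BlocksBelow-≤P : ∀ {r q N} → r ≤P q → BlocksBelow (Xc q) N → BlocksBelow (Xc r) N
BlocksBelow-≤P (_ , _ , ⊆X , _) blocks m<N decode≡ with blocks m<N decode≡
... | X , X∈ , σ⊏X with ⊆X X∈
... | Y , Y∈ , X≗Y = Y , Y∈ , ⊏-resp _ X≗Y σ⊏X

blockers : (Str → Real) → ℕ → List Real
blockers extend = applyUpTo (extend ∘ maybe ax-σ [] ∘ decodeAxiom)

blockers-blocksBelow : ∀ {extend} → (∀ τ → τ ⊏ extend τ) → ∀ N → BlocksBelow (blockers extend N) N
blockers-blocksBelow {extend} extends N {m} {a} m<N decode≡ =
  _ , ∈-applyUpTo⁺ (extend ∘ maybe ax-σ [] ∘ decodeAxiom) m<N
    , subst (λ d → ax-σ a ⊏ extend (maybe ax-σ [] d)) (sym decode≡) (extends (ax-σ a))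

blockers-avoid : ∀ A N → ¬ (A ∈ᵣ blockers (extendAvoiding A) N)
blockers-avoid A N (Y , Y∈ , A≗Y) with ∈-applyUpTo⁻ _ Y∈
... | m , _ , refl = not-¬ refl (trans (A≗Y (length τ)) (extendAvoiding-differs A τ))
  where τ = maybe ax-σ [] (decodeAxiom m)

InQ-withBlockers : ∀ A B q N → InQ A B q → InQ A B (withBlockers q (blockers (extendAvoiding A) N))
InQ-withBlockers A B q N (computes , A∉) = computes , λ (Y , Y∈ , A≗Y) →
  [ (λ Y∈q → A∉ (Y , Y∈q , A≗Y)) , (λ Y∈b → blockers-avoid A N (Y , Y∈b , A≗Y)) ]′
    (∈-++⁻ (Xc q) Y∈)

head-below : ∀ n {k N} → n + suc k ≤ N → n < N
head-below n ≤N = <-≤-trans (m<m+n n z<s) ≤N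

tail-below : ∀ n {k N} → n + suc k ≤ N → suc n + k ≤ N
tail-below n {k} {N} ≤N = subst (_≤ N) (+-suc n k) ≤N

AgreeBelow : ℕ → Functional → Functional → Set
AgreeBelow N Φ Φ′ = ∀ {m a} → m < N → decodeAxiom m ≡ just a →
  (a ∈ Φ → a ∈ Φ′) × (a ∈ Φ′ → a ∈ Φ)

AgreeBelow-sym : ∀ {N Φ Φ′} → AgreeBelow N Φ Φ′ → AgreeBelow N Φ′ Φ
AgreeBelow-sym agree m<N decode≡ = swap (agree m<N decode≡)

AgreeBelow-≤ : ∀ {Φ Φ′ M N} → M ≤ N → AgreeBelow N Φ Φ′ → AgreeBelow M Φ Φ′
AgreeBelow-≤ M≤N agree m<M = agree (<-≤-trans m<M M≤N)

≤P-agreeBelow : ∀ {r q N} → r ≤P q → BlocksBelow (Xc q) N → AgreeBelow N (Φc q) (Φc r)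
≤P-agreeBelow {r} {q} r≤q blocks m<N decode≡ with blocks m<N decode≡
... | X , X∈ , σ⊏X = proj₁ r≤q , blocked-∈ {r} {q} r≤q X∈ σ⊏X

-- A bound on the positions of G that a formula refers to.
depthᴬ : Atom → ℕ
depthᴬ (inGA σ) = length σ
depthᴬ _        = 0

depthᴸ : Literal → ℕ
depthᴸ (pos φ) = depthᴬ φ
depthᴸ (neg φ) = depthᴬ φ

depthᶜ : Clause → ℕ
depthᶜ (cLit l)   = depthᴸ l
depthᶜ (cDisj ls) = sum (map depthᴸ ls)

depth : QFSentence → ℕ
depth (sClause c) = depthᶜ c
depth (sConj cs)  = sum (map depthᶜ cs)

module Truth (comp : ℕ → ℕ → ℕ → ℕ → Str → Bool) (S : Real) where

  SatBit : Functional → ℕ → Bool → Set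
  SatBit Φ n true  = ∃ λ a → decodeAxiom n ≡ just a × a ∈ Φ
  SatBit Φ n false = decodeAxiom n ≡ nothing ⊎ ∃ λ a → decodeAxiom n ≡ just a × a ∉ Φ

  SatG : Functional → ℕ → Str → Set
  SatG Φ n []      = ⊤
  SatG Φ n (b ∷ σ) = SatBit Φ n b × SatG Φ (suc n) σ

  SatAtom : Functional → Atom → Set
  SatAtom Φ (eqA n m)         = n ≡ m
  SatAtom Φ (compA e x s y σ) = comp e x s y σ ≡ true
  SatAtom Φ (inSA σ)          = σ ⊏ S
  SatAtom Φ (inGA σ)          = SatG Φ 0 σ

  SatLit : Functional → Literal → Set
  SatLit Φ (pos φ) = SatAtom Φ φ
  SatLit Φ (neg φ) = ¬ SatAtom Φ φ

  SatClause : Functional → Clause → Set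
  SatClause Φ (cLit l)   = SatLit Φ l
  SatClause Φ (cDisj ls) = Any (SatLit Φ) ls

  Sat : Functional → QFSentence → Set
  Sat Φ (sClause c) = SatClause Φ c
  Sat Φ (sConj cs)  = All (SatClause Φ) cs

  satBit? : ∀ Φ n b → Dec (SatBit Φ n b)
  satBit? Φ n true with decodeAxiom n
  ... | nothing = no λ { (_ , () , _) }
  ... | just a  = map′ (λ a∈ → a , refl , a∈) (λ { (_ , refl , a∈) → a∈ }) (a ∈? Φ)
  satBit? Φ n false with decodeAxiom n
  ... | nothing = yes (inj₁ refl)
  ... | just a  = map′ (λ a∉ → inj₂ (a , refl , a∉))
                       (λ { (inj₁ ()) ; (inj₂ (_ , refl , a∉)) → a∉ })
                       (¬? (a ∈? Φ))

  satG? : ∀ Φ n σ → Dec (SatG Φ n σ)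
  satG? Φ n []      = yes tt
  satG? Φ n (b ∷ σ) = satBit? Φ n b ×-dec satG? Φ (suc n) σ

  satAtom? : ∀ Φ φ → Dec (SatAtom Φ φ)
  satAtom? Φ (eqA n m)         = n ℕ.≟ m
  satAtom? Φ (compA e x s y σ) = comp e x s y σ Bool.≟ true
  satAtom? Φ (inSA σ)          = σ ⊏? S
  satAtom? Φ (inGA σ)          = satG? Φ 0 σ

  satLit? : ∀ Φ l → Dec (SatLit Φ l)
  satLit? Φ (pos φ) = satAtom? Φ φ
  satLit? Φ (neg φ) = ¬? (satAtom? Φ φ)

  satClause? : ∀ Φ c → Dec (SatClause Φ c)
  satClause? Φ (cLit l)   = satLit? Φ l
  satClause? Φ (cDisj ls) = any? (satLit? Φ) ls

  sat? : ∀ Φ ψ → Dec (Sat Φ ψ)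
  sat? Φ (sClause c) = satClause? Φ c
  sat? Φ (sConj cs)  = all? (satClause? Φ) cs

  satG-transfer : ∀ {Φ Φ′ N} n σ → n + length σ ≤ N → AgreeBelow N Φ Φ′ →
                  SatG Φ n σ → SatG Φ′ n σ
  satG-transfer n []      _  _     _            = tt
  satG-transfer n (b ∷ σ) ≤N agree (bit , rest) =
    transferBit b bit , satG-transfer (suc n) σ (tail-below n ≤N) agree rest
    where
      transferBit : ∀ b → SatBit _ n b → SatBit _ n b
      transferBit true  (a , decode≡ , a∈) =
        a , decode≡ , proj₁ (agree (head-below n ≤N) decode≡) a∈
      transferBit false (inj₁ decode≡)     = inj₁ decode≡
      transferBit false (inj₂ (a , decode≡ , a∉)) =
        inj₂ (a , decode≡ , a∉ ∘ proj₂ (agree (head-below n ≤N) decode≡))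

  satAtom-transfer : ∀ {Φ Φ′} φ → AgreeBelow (depthᴬ φ) Φ Φ′ → SatAtom Φ φ → SatAtom Φ′ φ
  satAtom-transfer (eqA _ _)         _     sat = sat
  satAtom-transfer (compA _ _ _ _ _) _     sat = sat
  satAtom-transfer (inSA _)          _     sat = sat
  satAtom-transfer (inGA σ)          agree sat = satG-transfer 0 σ ≤-refl agree sat

  satLit-transfer : ∀ {Φ Φ′} l → AgreeBelow (depthᴸ l) Φ Φ′ → SatLit Φ l → SatLit Φ′ l
  satLit-transfer (pos φ) agree sat   = satAtom-transfer φ agree sat
  satLit-transfer (neg φ) agree ¬sat  = ¬sat ∘ satAtom-transfer φ (AgreeBelow-sym agree)

  satAny-transfer : ∀ {Φ Φ′} ls → AgreeBelow (sum (map depthᴸ ls)) Φ Φ′ →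
                    Any (SatLit Φ) ls → Any (SatLit Φ′) ls
  satAny-transfer (l ∷ ls) agree (here sat)  =
    here (satLit-transfer l (AgreeBelow-≤ (m≤m+n _ _) agree) sat)
  satAny-transfer (l ∷ ls) agree (there sat) =
    there (satAny-transfer ls (AgreeBelow-≤ (m≤n+m _ _) agree) sat)

module Freezing (comp : ℕ → ℕ → ℕ → ℕ → Str → Bool) (S : Real)
                (InPos : Condition → Set) (Extra : Axiom → Set)
                (extend : Str → Real) (extends : ∀ τ → τ ⊏ extend τ)
                (InPos-withBlockers : ∀ q N → InPos q →
                                      InPos (withBlockers q (blockers extend N)))
                where

  open Forcing comp S InPos Extra
  open Truth comp S

  freeze : Condition → ℕ → Condition
  freeze q N = withBlockers q (blockers extend N)

  freeze-blocksBelow : ∀ q N → BlocksBelow (Xc (freeze q N)) N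
  freeze-blocksBelow q N m<N decode≡ with blockers-blocksBelow extends N m<N decode≡
  ... | X , X∈ , σ⊏X = X , ∈-++⁺ʳ (Xc q) X∈ , σ⊏X

  forcesG⇒satG : ∀ p n σ → ForcesG p n σ → SatG (Φc p) n σ
  forcesG⇒satG p n []          _                     = tt
  forcesG⇒satG p n (true ∷ σ)  (bit , rest)          = bit , forcesG⇒satG p (suc n) σ rest
  forcesG⇒satG p n (false ∷ σ) (inj₁ decode≡ , rest) = inj₁ decode≡ , forcesG⇒satG p (suc n) σ rest
  forcesG⇒satG p n (false ∷ σ) (inj₂ (a , decode≡ , a∉ , _) , rest) =
    inj₂ (a , decode≡ , a∉) , forcesG⇒satG p (suc n) σ rest

  satG⇒forcesG : ∀ p {N} n σ → BlocksBelow (Xc p) N → n + length σ ≤ N →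
                 SatG (Φc p) n σ → ForcesG p n σ
  satG⇒forcesG p n []      _      _  _            = tt
  satG⇒forcesG p n (b ∷ σ) blocks ≤N (bit , rest) =
    forceBit b bit , satG⇒forcesG p (suc n) σ blocks (tail-below n ≤N) rest
    where
      forceBit : ∀ b → SatBit (Φc p) n b → GBit p n b
      forceBit true  bit                         = bit
      forceBit false (inj₁ decode≡)              = inj₁ decode≡
      forceBit false (inj₂ (a , decode≡ , a∉)) =
        inj₂ (a , decode≡ , a∉ , inj₂ (inj₂ (inj₁ (blocks (head-below n ≤N) decode≡))))

  forcesAtom⇒sat : ∀ p φ → ForcesAtom p φ → SatAtom (Φc p) φ
  forcesAtom⇒sat p (eqA _ _)         forced = forced
  forcesAtom⇒sat p (compA _ _ _ _ _) forced = forced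
  forcesAtom⇒sat p (inSA _)          forced = forced
  forcesAtom⇒sat p (inGA σ)          forced = forcesG⇒satG p 0 σ forced

  sat⇒forcesAtom : ∀ p φ → BlocksBelow (Xc p) (depthᴬ φ) →
                   SatAtom (Φc p) φ → ForcesAtom p φ
  sat⇒forcesAtom p (eqA _ _)         _      sat = sat
  sat⇒forcesAtom p (compA _ _ _ _ _) _      sat = sat
  sat⇒forcesAtom p (inSA _)          _      sat = sat
  sat⇒forcesAtom p (inGA σ)          blocks sat = satG⇒forcesG p 0 σ blocks ≤-refl sat

  sat⇒forcesLit : ∀ q l → BlocksBelow (Xc q) (depthᴸ l) → SatLit (Φc q) l → ForcesLit q l
  sat⇒forcesLit q (pos φ) blocks sat = sat⇒forcesAtom q φ blocks sat
  sat⇒forcesLit q (neg φ) blocks ¬sat (r , _ , r≤q , forced) =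
    ¬sat (satAtom-transfer φ (AgreeBelow-sym (≤P-agreeBelow {r} {q} r≤q blocks))
                             (forcesAtom⇒sat r φ forced))

  sat⇒forcesAny : ∀ r ls → BlocksBelow (Xc r) (sum (map depthᴸ ls)) →
                  Any (SatLit (Φc r)) ls → AnyLit r ls
  sat⇒forcesAny r (l ∷ ls) blocks (here sat)  =
    here (sat⇒forcesLit r l (BlocksBelow-≤ (m≤m+n _ _) blocks) sat)
  sat⇒forcesAny r (l ∷ ls) blocks (there sat) =
    there (sat⇒forcesAny r ls (BlocksBelow-≤ (m≤n+m _ _) blocks) sat)

  sat⇒forcesClause : ∀ q c → BlocksBelow (Xc q) (depthᶜ c) →
                     SatClause (Φc q) c → ForcesClause q c
  sat⇒forcesClause q (cLit l)   blocks sat = sat⇒forcesLit q l blocks sat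
  sat⇒forcesClause q (cDisj ls) blocks sat r inPos r≤q =
    r , inPos , ≤P-refl r ,
    sat⇒forcesAny r ls (BlocksBelow-≤P {r} {q} r≤q blocks)
                       (satAny-transfer ls (≤P-agreeBelow {r} {q} r≤q blocks) sat)

  sat⇒forcesAll : ∀ q cs → BlocksBelow (Xc q) (sum (map depthᶜ cs)) →
                  All (SatClause (Φc q)) cs → AllClauses q cs
  sat⇒forcesAll q []       _      []           = []
  sat⇒forcesAll q (c ∷ cs) blocks (sat ∷ sats) =
    sat⇒forcesClause q c (BlocksBelow-≤ (m≤m+n _ _) blocks) sat
      ∷ sat⇒forcesAll q cs (BlocksBelow-≤ (m≤n+m _ _) blocks) sats

  sat⇒forces : ∀ q ψ → BlocksBelow (Xc q) (depth ψ) → Sat (Φc q) ψ → Forces q ψ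
  sat⇒forces q (sClause c) = sat⇒forcesClause q c
  sat⇒forces q (sConj cs)  = sat⇒forcesAll q cs

  forces⇒satLit : ∀ q l → InPos q → ForcesLit q l → SatLit (Φc q) l
  forces⇒satLit q (pos φ) _     forced     = forcesAtom⇒sat q φ forced
  forces⇒satLit q (neg φ) inPos ¬forced sat =
    ¬forced (freeze q N , InPos-withBlockers q N inPos , withBlockers-≤P q _ ,
             sat⇒forcesAtom (freeze q N) φ (freeze-blocksBelow q N) sat)
    where N = depthᴬ φ

  forces⇒satAny : ∀ r ls → InPos r → AnyLit r ls → Any (SatLit (Φc r)) ls
  forces⇒satAny r (l ∷ ls) inPos (here forced)  = here (forces⇒satLit r l inPos forced)
  forces⇒satAny r (l ∷ ls) inPos (there forced) = there (forces⇒satAny r ls inPos forced)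

  forces⇒satClause : ∀ q c → InPos q → ForcesClause q c → SatClause (Φc q) c
  forces⇒satClause q (cLit l)   inPos forced = forces⇒satLit q l inPos forced
  forces⇒satClause q (cDisj ls) inPos forced
    with forced (freeze q N) (InPos-withBlockers q N inPos) (withBlockers-≤P q _)
    where N = sum (map depthᴸ ls)
  ... | s , inPosₛ , s≤q′ , forcedₛ =
    satAny-transfer ls
      (AgreeBelow-sym (≤P-agreeBelow {s} {freeze q _} s≤q′ (freeze-blocksBelow q _)))
      (forces⇒satAny s ls inPosₛ forcedₛ)

  forces⇒satAll : ∀ q cs → InPos q → AllClauses q cs → All (SatClause (Φc q)) cs
  forces⇒satAll q []       _     []                = []
  forces⇒satAll q (c ∷ cs) inPos (forced ∷ forceds) =
    forces⇒satClause q c inPos forced ∷ forces⇒satAll q cs inPos forceds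

  forces⇒sat : ∀ q ψ → InPos q → Forces q ψ → Sat (Φc q) ψ
  forces⇒sat q (sClause c) = forces⇒satClause q c
  forces⇒sat q (sConj cs)  = forces⇒satAll q cs

  sat⇔forcible : ∀ Φ₀ (fun : IsTuringFunctional Φ₀) (um : IsUseMonotone Φ₀) ψ →
    ((∃ λ Xs → InPos (cond Φ₀ fun um Xs)) × Sat Φ₀ ψ)
      ⇔ (∃ λ Xs → InPos (cond Φ₀ fun um Xs) × Forces (cond Φ₀ fun um Xs) ψ)
  sat⇔forcible Φ₀ fun um ψ = mk⇔
    (λ ((Xs , inPos) , sat) →
      let q = cond Φ₀ fun um Xs in
      Xs ++ blockers extend (depth ψ) , InPos-withBlockers q (depth ψ) inPos ,
      sat⇒forces (freeze q (depth ψ)) ψ (freeze-blocksBelow q (depth ψ)) sat)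
    (λ (Xs , inPos , forced) → (Xs , inPos) , forces⇒sat (cond Φ₀ fun um Xs) ψ inPos forced)

  forcible? : ∀ Φ₀ (fun : IsTuringFunctional Φ₀) (um : IsUseMonotone Φ₀) ψ →
    Dec (∃ λ Xs → InPos (cond Φ₀ fun um Xs)) →
    Dec (∃ λ Xs → InPos (cond Φ₀ fun um Xs) × Forces (cond Φ₀ fun um Xs) ψ)
  forcible? Φ₀ fun um ψ inPos? = Dec.map (sat⇔forcible Φ₀ fun um ψ) (inPos? ×-dec sat? Φ₀ ψ)

forcibleP? : ∀ comp S Φ₀ (fun : IsTuringFunctional Φ₀) (um : IsUseMonotone Φ₀) ψ →
  Dec (∃ λ Xs → ForcesP comp S (cond Φ₀ fun um Xs) ψ)
forcibleP? comp S Φ₀ fun um ψ =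
  map′ (λ (Xs , _ , forced) → Xs , forced) (λ (Xs , forced) → Xs , tt , forced)
    (Freezing.forcible? comp S (λ _ → ⊤) (λ _ → ⊥)
       (extendAvoiding (λ _ → false)) (⊏-extendAvoiding (λ _ → false)) (λ _ _ _ → tt)
       Φ₀ fun um ψ (yes ([] , tt)))

inQ? : ∀ A B Φ₀ (fun : IsTuringFunctional Φ₀) (um : IsUseMonotone Φ₀) →
  Dec (∃ λ Xs → InQ A B (cond Φ₀ fun um Xs))
inQ? A B Φ₀ fun um =
  map′ (λ (computes : PartiallyComputes Φ₀ A B) → [] , computes , λ { (_ , () , _) })
       (proj₁ ∘ proj₂)
       (partiallyComputes? Φ₀ A B)

forcibleQ? : ∀ comp A B S Φ₀ (fun : IsTuringFunctional Φ₀) (um : IsUseMonotone Φ₀) ψ →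
  Dec (∃ λ Xs → InQ A B (cond Φ₀ fun um Xs) × ForcesQ comp A B S (cond Φ₀ fun um Xs) ψ)
forcibleQ? comp A B S Φ₀ fun um ψ =
  Freezing.forcible? comp S (InQ A B) (λ a → ax-σ a ⊏ A × ax-y a ≢ B (ax-x a))
    (extendAvoiding A) (⊏-extendAvoiding A) (InQ-withBlockers A B)
    Φ₀ fun um ψ (inQ? A B Φ₀ fun um)

mainTheorem4 : (comp : ℕ → ℕ → ℕ → ℕ → Str → Bool) →
    ((S : Real) (Φ₀ : Functional) (fun : IsTuringFunctional Φ₀) (um : IsUseMonotone Φ₀)
      (ψ : QFSentence) →
      Dec (∃ λ (Xs : List Real) → ForcesP comp S (cond Φ₀ fun um Xs) ψ))
    × ((A B S : Real) (Φ₀ : Functional) (fun : IsTuringFunctional Φ₀) (um : IsUseMonotone Φ₀)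
      (ψ : QFSentence) →
      Dec (∃ λ (Xs : List Real) →
        InQ A B (cond Φ₀ fun um Xs) × ForcesQ comp A B S (cond Φ₀ fun um Xs) ψ))
mainTheorem4 comp = forcibleP? comp , forcibleQ? comp
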